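{- Let $A:\mathcal U^e$ be an exo-type such that for any type family $Y:A\to\mathcal U$ the exo-type $\prod^e_{a:A}Y(a)$ is fibrant; for each $Y$ write $FM_Y:\mathcal U$ for its fibrant match, with mutually inverse exo-isomorphisms $r_Y:\prod^e_{a:A}Y(a)\to FM_Y$ and $s_Y:FM_Y\to\prod^e_{a:A}Y(a)$. Then the following are (logically) equivalent: (i) For any $Y:A\to\mathcal U$, if $Y(a)$ is contractible for each $a:A$, then the fibrant match $FM_Y$ of $\prod^e_{a:A}Y(a)$ is contractible (that is, $A$ is cofibrant). (ii) (Function extensionality for cofibrant types.) For any $Y:A\to\mathcal U$ and any $f,g:\prod^e_{a:A}Y(a)$, if $f(a)=g(a)$ for each $a:A$, then $r_Y(f)=r_Y(g)$ in $FM_Y$.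
   Context: Setting: two-level type theory (2LTT). There is a hierarchy of universes $\mathcal U$ whose terms are called types and which obeys homotopy type theory (with the usual $\prod,\sum,+,\mathbf 1,\mathbf 0,\mathbb N$ and identity type $=$), and a hierarchy of exo-universes $\mathcal U^e$ whose terms are called exo-types, with their own formers $\prod^e,\sum^e,+^e,\mathbf 1^e,\mathbf 0^e,\mathbb N^e$ and exo-equality $=^e$. Every type is also an exo-type. Exo-level inductive exo-types eliminate into arbitrary exo-types, while inductive types eliminate only into types. Axioms: univalence (hence function extensionality) for $=$; function extensionality and uniqueness of identity proofs for $=^e$. Exo-equality between terms of a type implies identity. An exo-isomorphism $A\cong B$ of exo-types consists of $f:A\to B$, $g:B\to A$ with $f\circ g=^e\mathrm{id}_B$ and $g\circ f=^e\mathrm{id}_A$. An exo-type $A$ is fibrant if there is a type $RA:\mathcal U$ (called its fibrant match) with $A\cong RA$. Contractible means contractible with respect to $=$. An exo-type $A$ is cofibrant if (1) for any $Y:A\to\mathcal U$ the exo-type $\prod^e_{a:A}Y(a)$ is fibrant, and (2) in that case, if each $Y(a)$ is contractible, then so is the fibrant match of $\prod^e_{a:A}Y(a)$. -}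

{-# OPTIONS --with-K #-}
module Defs where

open import Level using (Level; _⊔_; Setω) renaming (zero to lzero; suc to lsuc)
open import Function.Base using (_∘_; id)
open import Relation.Binary.PropositionalEquality using (_≡_; refl; sym; subst)
open import Axiom.Extensionality.Propositional using (Extensionality)
open import Axiom.UniquenessOfIdentityProofs using (UIP)
import Axiom.UniquenessOfIdentityProofs.WithK as WithK

-- Two-level type theory is rendered with Agda itself as the outer level:
-- exo-universes are the universes Set ℓ, exo-type formers are Agda's own, and
-- exo-equality is _≡_, which satisfies UIP because K is enabled.

uipᵉ : ∀ {ℓ} {A : Set ℓ} → UIP A
uipᵉ = WithK.uip

-- Exo-isomorphism; the inverse laws are equalities of functions.
record _≅_ {a b : Level} (A : Set a) (B : Set b) : Set (a ⊔ b) where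
  field
    to      : A → B
    from    : B → A
    to∘from : to ∘ from ≡ id
    from∘to : from ∘ to ≡ id

-- The inner level is a hierarchy of universes U ℓ à la Tarski, with El turning
-- a type into the exo-type of its terms.  A term in a context of the inner level
-- is an Agda function on El, so binders are higher-order.  Computation rules
-- hold up to exo-equality, and the eliminators of inductive types only take
-- motives valued in U.
record Types : Setω where
  infixr 2 _+_
  field
    U  : (ℓ : Level) → Set (lsuc ℓ)
    El : ∀ {ℓ} → U ℓ → Set ℓ

    -- U ℓ is itself a type, of the next universe.
    𝒰       : (ℓ : Level) → U (lsuc ℓ)
    𝒰-terms : ∀ {ℓ} → El (𝒰 ℓ) ≅ U ℓ

    Π   : ∀ {ℓ ℓ'} (A : U ℓ) (B : El A → U ℓ') → U (ℓ ⊔ ℓ')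
    lam : ∀ {ℓ ℓ'} {A : U ℓ} {B : El A → U ℓ'} → ((x : El A) → El (B x)) → El (Π A B)
    app : ∀ {ℓ ℓ'} {A : U ℓ} {B : El A → U ℓ'} → El (Π A B) → (x : El A) → El (B x)
    Π-β : ∀ {ℓ ℓ'} {A : U ℓ} {B : El A → U ℓ'} (f : (x : El A) → El (B x)) →
          app (lam {B = B} f) ≡ f
    Π-η : ∀ {ℓ ℓ'} {A : U ℓ} {B : El A → U ℓ'} (f : El (Π A B)) → lam (app f) ≡ f

    Σ      : ∀ {ℓ ℓ'} (A : U ℓ) (B : El A → U ℓ') → U (ℓ ⊔ ℓ')
    pair   : ∀ {ℓ ℓ'} {A : U ℓ} {B : El A → U ℓ'} (x : El A) → El (B x) → El (Σ A B)
    Σ-elim : ∀ {ℓ ℓ' m} {A : U ℓ} {B : El A → U ℓ'} (C : El (Σ A B) → U m) →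
             ((x : El A) (y : El (B x)) → El (C (pair x y))) →
             (z : El (Σ A B)) → El (C z)
    Σ-β    : ∀ {ℓ ℓ' m} {A : U ℓ} {B : El A → U ℓ'} (C : El (Σ A B) → U m)
             (c : (x : El A) (y : El (B x)) → El (C (pair x y))) (x : El A) (y : El (B x)) →
             Σ-elim C c (pair x y) ≡ c x y

    _+_    : ∀ {ℓ ℓ'} → U ℓ → U ℓ' → U (ℓ ⊔ ℓ')
    inl    : ∀ {ℓ ℓ'} {A : U ℓ} {B : U ℓ'} → El A → El (A + B)
    inr    : ∀ {ℓ ℓ'} {A : U ℓ} {B : U ℓ'} → El B → El (A + B)
    +-elim : ∀ {ℓ ℓ' m} {A : U ℓ} {B : U ℓ'} (C : El (A + B) → U m) →
             ((x : El A) → El (C (inl x))) → ((y : El B) → El (C (inr y))) →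
             (z : El (A + B)) → El (C z)
    +-β₁   : ∀ {ℓ ℓ' m} {A : U ℓ} {B : U ℓ'} (C : El (A + B) → U m)
             (c : (x : El A) → El (C (inl x))) (d : (y : El B) → El (C (inr y))) (x : El A) →
             +-elim C c d (inl x) ≡ c x
    +-β₂   : ∀ {ℓ ℓ' m} {A : U ℓ} {B : U ℓ'} (C : El (A + B) → U m)
             (c : (x : El A) → El (C (inl x))) (d : (y : El B) → El (C (inr y))) (y : El B) →
             +-elim C c d (inr y) ≡ d y

    𝟏      : U lzero
    ⋆      : El 𝟏
    𝟏-elim : ∀ {m} (C : El 𝟏 → U m) → El (C ⋆) → (z : El 𝟏) → El (C z)
    𝟏-β    : ∀ {m} (C : El 𝟏 → U m) (c : El (C ⋆)) → 𝟏-elim C c ⋆ ≡ c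

    𝟎      : U lzero
    𝟎-elim : ∀ {m} (C : El 𝟎 → U m) (z : El 𝟎) → El (C z)

    ℕ      : U lzero
    zero   : El ℕ
    succ   : El ℕ → El ℕ
    ℕ-elim : ∀ {m} (C : El ℕ → U m) → El (C zero) →
             ((n : El ℕ) → El (C n) → El (C (succ n))) → (n : El ℕ) → El (C n)
    ℕ-β₀   : ∀ {m} (C : El ℕ → U m) (c : El (C zero))
             (s : (n : El ℕ) → El (C n) → El (C (succ n))) →
             ℕ-elim C c s zero ≡ c
    ℕ-βₛ   : ∀ {m} (C : El ℕ → U m) (c : El (C zero))
             (s : (n : El ℕ) → El (C n) → El (C (succ n))) (n : El ℕ) →
             ℕ-elim C c s (succ n) ≡ s n (ℕ-elim C c s n)

    Id  : ∀ {ℓ} {A : U ℓ} → El A → El A → U ℓ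
    rfl : ∀ {ℓ} {A : U ℓ} (x : El A) → El (Id x x)
    J   : ∀ {ℓ m} {A : U ℓ} (C : (x y : El A) → El (Id x y) → U m) →
          ((x : El A) → El (C x x (rfl x))) →
          (x y : El A) (p : El (Id x y)) → El (C x y p)
    J-β : ∀ {ℓ m} {A : U ℓ} (C : (x y : El A) → El (Id x y) → U m)
          (c : (x : El A) → El (C x x (rfl x))) (x : El A) →
          J C c x x (rfl x) ≡ c x

  decode : ∀ {ℓ} → El (𝒰 ℓ) → U ℓ
  decode = _≅_.to 𝒰-terms

  isContr : ∀ {ℓ} → U ℓ → U ℓ
  isContr A = Σ A λ c → Π A λ x → Id c x

  fib : ∀ {ℓ ℓ'} {A : U ℓ} {B : U ℓ'} → (El A → El B) → El B → U (ℓ ⊔ ℓ')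
  fib {A = A} f y = Σ A λ x → Id (f x) y

  isEquiv : ∀ {ℓ ℓ'} {A : U ℓ} {B : U ℓ'} → (El A → El B) → U (ℓ ⊔ ℓ')
  isEquiv {A = A} {B} f = Π B λ y → isContr (fib {A = A} {B} f y)

  _≃_ : ∀ {ℓ ℓ'} → U ℓ → U ℓ' → U (ℓ ⊔ ℓ')
  A ≃ B = Σ (Π A λ _ → B) λ f → isEquiv {A = A} {B} (app f)

  id-isEquiv : ∀ {ℓ} (A : U ℓ) → El (isEquiv {A = A} {A} id)
  id-isEquiv A = lam λ y → pair (pair y (rfl y)) (lam λ z →
    Σ-elim (λ z → Id (pair y (rfl y)) z)
           (λ x p → J (λ x y p → Id {A = fib {A = A} {A} id y} (pair y (rfl y)) (pair x p))
                      (λ x → rfl (pair x (rfl x))) x y p)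
           z)

  idEquiv : ∀ {ℓ} (A : U ℓ) → El (A ≃ A)
  idEquiv A = pair (lam id)
    (subst (λ f → El (isEquiv {A = A} {A} f)) (sym (Π-β id)) (id-isEquiv A))

  idToEquiv : ∀ {ℓ} (A B : El (𝒰 ℓ)) → El (Id A B) → El (decode A ≃ decode B)
  idToEquiv = J (λ A B _ → decode A ≃ decode B) (λ A → idEquiv (decode A))

  Univalence : Setω
  Univalence = ∀ {ℓ} (A B : El (𝒰 ℓ)) →
    El (isEquiv {A = Id A B} {decode A ≃ decode B} (idToEquiv A B))

record TwoLevelTT : Setω where
  field
    types      : Types
    univalence : Types.Univalence types
    funextᵉ    : ∀ {a b} → Extensionality a b
  open Types types public

  record IsFibrant {ℓ : Level} (B : Set ℓ) : Set (lsuc ℓ) where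
    field
      match : U ℓ
      iso   : B ≅ El match

  FM : ∀ {ℓ} {B : Set ℓ} → IsFibrant B → U ℓ
  FM = IsFibrant.match

  r : ∀ {ℓ} {B : Set ℓ} (φ : IsFibrant B) → B → El (FM φ)
  r φ = _≅_.to (IsFibrant.iso φ)

{-# OPTIONS --safe #-}
module Submission where

-- (i) ⇒ (ii): the fibres Σ x, x = f(a) of the identity are contractible, hence
-- so is the match of their product.  It therefore identifies the points coming
-- from (f(a), refl) and from (g(a), h(a)⁻¹); apply to this path the
-- map of matches induced by the first projection.
-- (ii) ⇒ (i): the pointwise centres give a point of the match, and every other
-- point is r of a family that is pointwise equal to the centres.

open import Level using (Level)
open import Function.Base using (id)
open import Function.Bundles using (_⇔_; mk⇔)
open import Relation.Binary.PropositionalEquality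
  using (_≡_; cong; cong-app; subst; subst₂; trans)
open import Defs

module _ (𝕋 : TwoLevelTT) where
  open TwoLevelTT 𝕋

  private variable
    ℓ ℓ' : Level

  Id-sym : {A : U ℓ} {x y : El A} → El (Id x y) → El (Id y x)
  Id-sym {x = x} {y} = J (λ x y _ → Id y x) rfl x y

  Id-trans : {A : U ℓ} {x y z : El A} → El (Id x y) → El (Id y z) → El (Id x z)
  Id-trans {A = A} {x} {y} {z} p =
    app (J (λ x y _ → Π (Id y z) λ _ → Id x z) (λ _ → lam id) x y p)

  Id-cong : {A : U ℓ} {B : U ℓ'} (F : El A → El B) {x y : El A} →
            El (Id x y) → El (Id (F x) (F y))
  Id-cong F {x} {y} = J (λ x y _ → Id (F x) (F y)) (λ x → rfl (F x)) x y

  fst : {A : U ℓ} {B : El A → U ℓ'} → El (Σ A B) → El A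
  fst {A = A} = Σ-elim (λ _ → A) (λ x _ → x)

  -- `Σ-β` is an exo-equality, so projecting from a pair calls for an explicit rewrite.
  fst-pair : {A : U ℓ} {B : El A → U ℓ'} (x : El A) (y : El (B x)) →
             fst {B = B} (pair x y) ≡ x
  fst-pair {A = A} = Σ-β (λ _ → A) (λ x _ → x)

  contr⇒Id : {A : U ℓ} → El (isContr A) → (x y : El A) → El (Id x y)
  contr⇒Id c x y =
    Σ-elim (λ _ → Id x y) (λ _ p → Id-trans (Id-sym (app p x)) (app p y)) c

  s : {B : Set ℓ} (φ : IsFibrant B) → El (FM φ) → B
  s φ = _≅_.from (IsFibrant.iso φ)

  r∘s : {B : Set ℓ} (φ : IsFibrant B) (x : El (FM φ)) → r φ (s φ x) ≡ x
  r∘s φ = cong-app (_≅_.to∘from (IsFibrant.iso φ))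

  s∘r : {B : Set ℓ} (φ : IsFibrant B) (b : B) → s φ (r φ b) ≡ b
  s∘r φ = cong-app (_≅_.from∘to (IsFibrant.iso φ))

  module _ (A : Set ℓ) (φ : (Y : A → U ℓ') → IsFibrant ((a : A) → El (Y a))) where

    PreservesContr : Set _
    PreservesContr = (Y : A → U ℓ') →
      ((a : A) → El (isContr (Y a))) → El (isContr (FM (φ Y)))

    FunExt : Set _
    FunExt = (Y : A → U ℓ') (f g : (a : A) → El (Y a)) →
      ((a : A) → El (Id (f a) (g a))) → El (Id (r (φ Y) f) (r (φ Y) g))

    preservesContr⇒funExt : PreservesContr → FunExt
    preservesContr⇒funExt contr Y f g h =
      subst₂ (λ u v → El (Id u v))
        (project-r f (λ a → rfl (f a)))
        (project-r g (λ a → Id-sym (h a)))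
        -- The points left implicit are `r (φ P)` of the two families of pairs, fixed by the
        -- `project-r` terms.
        (Id-cong project (contr⇒Id (contr P P-contr) _ _))
      where
      P : A → U ℓ'
      P a = fib {A = Y a} {Y a} id (f a)

      -- An equivalence has contractible fibres, and `P a` is a fibre of the identity.
      P-contr : (a : A) → El (isContr (P a))
      P-contr a = app (id-isEquiv (Y a)) (f a)

      project : El (FM (φ P)) → El (FM (φ Y))
      project z = r (φ Y) (λ a → fst (s (φ P) z a))

      -- The round trip through `FM (φ P)` cancels by `s∘r`. A general `k` covers both endpoints.
      project-r : (k : (a : A) → El (Y a)) (p : (a : A) → El (Id (k a) (f a))) →
                  project (r (φ P) (λ a → pair (k a) (p a))) ≡ r (φ Y) k
      project-r k p = trans
        (cong (λ q → r (φ Y) (λ a → fst (q a))) (s∘r (φ P) _))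
        -- Exo-level extensionality suffices, as `fst-pair` is an exo-equality at each `a`.
        (cong (r (φ Y)) (funextᵉ λ a → fst-pair (k a) (p a)))

    funExt⇒preservesContr : FunExt → PreservesContr
    funExt⇒preservesContr ext Y c = pair (r (φ Y) centre) (lam λ x →
      -- `ext` only reaches points of the form `r (φ Y) k`; `r∘s` rewrites `x` as one, with `k`
      -- being `s (φ Y) x`.
      subst (λ y → El (Id (r (φ Y) centre) y)) (r∘s (φ Y) x)
        (ext Y centre (s (φ Y) x) λ a → contr⇒Id (c a) _ _))
      where
      centre : (a : A) → El (Y a)
      centre a = fst (c a)

proposition2p14 : (𝕋 : TwoLevelTT) → let open TwoLevelTT 𝕋 in
    {ℓ ℓ' : Level} (A : Set ℓ)
    (φ : (Y : A → U ℓ') → IsFibrant ((a : A) → El (Y a))) →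
    ((Y : A → U ℓ') → ((a : A) → El (isContr (Y a))) → El (isContr (FM (φ Y))))
    ⇔
    ((Y : A → U ℓ') (f g : (a : A) → El (Y a)) →
    ((a : A) → El (Id (f a) (g a))) → El (Id (r (φ Y) f) (r (φ Y) g)))
proposition2p14 𝕋 A φ =
  mk⇔ (preservesContr⇒funExt 𝕋 A φ) (funExt⇒preservesContr 𝕋 A φ)
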